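{- Let $\mathcal I,\mathcal J$ be ideals on $\omega$ and let $\mathcal F\subseteq\omega^\omega$. If $\mathfrak{fip}(\mathcal I,\mathcal J,\mathcal F)\ge|\mathcal F|$, then there exists an ultrafilter $\mathcal U$ on $\omega$ such that $\mathcal I\not\le_{\mathcal F}\mathcal U^*$ and $\mathcal J\subseteq\mathcal U^*$. In particular, if (under this assumption) $\mathcal F=\omega^\omega$ ($\mathcal F$ is the family of all finite-to-one functions, or $\mathcal F$ is the family of all one-to-one functions $\omega\to\omega$, respectively), then there exists an $\mathcal I$-ultrafilter (a weak $\mathcal I$-ultrafilter, or an $\mathcal I$-point, respectively) which is not a $\mathcal J$-point.
   Context: An ideal on $\omega$ is a family of subsets of $\omega$ closed under finite unions and subsets, containing all finite sets and not containing $\omega$; $\mathcal J^+=\mathcal P(\omega)\setminus\mathcal J$. Ultrafilters on $\omega$ contain all cofinite sets; $\mathcal U^*=\{\omega\setminus A:A\in\mathcal U\}$ is the dual ideal. For $\mathcal F\subseteq\omega^\omega$ and ideals $\mathcal I,\mathcal K$ on $\omega$, $\mathcal I\le_{\mathcal F}\mathcal K$ means that there is $f\in\mathcal F$ with $f^{ -1}[B]\in\mathcal K$ for every $B\in\mathcal I$. A nonempty family $\mathcal A\subseteq\mathcal P(\omega)$ has $\mathcal J^+$-FIP if $\bigcap F\in\mathcal J^+$ for each finite $F\subseteq\mathcal A$. With $\mathfrak c=2^{\aleph_0}$ and $\mathfrak c^+$ its successor cardinal, $\mathfrak{fip}(\mathcal I,\mathcal J,\mathcal F)$ is the minimum of the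 set consisting of $\mathfrak c^+$ and all cardinals $|\mathcal A|$ such that $\mathcal A$ has $\mathcal J^+$-FIP (so $\mathcal A$ is a nonempty family of subsets of $\omega$) and it is not true that for every $f\in\mathcal F$ there is $B\in\mathcal I$ such that $\mathcal A\cup\{f^{ -1}[B]\}$ has $\mathcal J^+$-FIP. An ultrafilter $\mathcal U$ on $\omega$ is an $\mathcal I$-ultrafilter (weak $\mathcal I$-ultrafilter, $\mathcal I$-point, respectively) if $\mathcal I\not\le_{\mathcal F}\mathcal U^*$ where $\mathcal F$ is the family of all (all finite-to-one, all one-to-one, respectively) functions $\omega\to\omega$; a $\mathcal J$-point is defined in the same way with $\mathcal J$ in place of $\mathcal I$. A function is finite-to-one if preimages of points are finite.
   Formalization: The general claim excludes the case |F| = fip(I,J,F) = 1, where it can fail (I = J, F = {id}: then fip = 1, but no ultrafilter works); the three "in particular" claims are proved without this exclusion. -}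

module Defs where

open import Axiom.ExcludedMiddle using (ExcludedMiddle)
open import Data.Bool.Base using (Bool)
open import Data.Fin.Base using (Fin)
open import Data.List.Base using (List; foldr)
open import Data.List.Membership.Propositional using () renaming (_∈_ to _∈ˡ_)
open import Data.List.Relation.Unary.All using (All)
open import Data.Nat.Base using (ℕ)
open import Data.Product.Base using (Σ; ∃; ∃-syntax; _×_; proj₁)
open import Data.Sum.Base using (_⊎_)
open import Function.Bundles using (Func; Surjection; Injection; Bijection)
open import Function.Definitions using (Injective)
open import Level using (Level; Setω; 0ℓ; _⊔_) renaming (suc to lsuc)
open import Relation.Binary.Bundles using (Setoid)
import Relation.Binary.Construct.On as On
open import Relation.Binary.PropositionalEquality using (_≡_; setoid; _→-setoid_)
open import Relation.Nullary.Negation using (¬_)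
open import Relation.Unary using (Pred; _∈_; _∉_; _⊆_; _≐_; _∪_; _∩_; ∁; U; ∅; ｛_｝; _⊢_)
open import Relation.Unary.Relation.Binary.Equality using (≐-setoid)

private variable
  a b ℓ ℓ₁ ℓ₂ : Level

-- The mathematics takes place in ZFC.  The two classical principles are
-- formulated here so that they can be assumed explicitly.  Sets with their
-- equality are setoids, so choice says that every surjection of setoids has a
-- section which itself respects equality.

Classical : Setω
Classical = ∀ {ℓ} → ExcludedMiddle ℓ

Choice : Setω
Choice = ∀ {a ℓ₁ b ℓ₂} {S : Setoid a ℓ₁} {T : Setoid b ℓ₂} (p : Surjection S T) →
  Σ (Func T S) λ s → ∀ y → Setoid._≈_ T (Surjection.to p (Func.to s y)) y

-- Equality of subsets is _≐_ and equality of functions is pointwise.  A family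
-- need not be closed under these equalities: it stands for the collection of
-- its members up to them, which is how its cardinality is defined below.

Subset : Set₁
Subset = Pred ℕ 0ℓ

Family : ∀ ℓ → Set (lsuc 0ℓ ⊔ lsuc ℓ)
Family ℓ = Pred Subset ℓ

FunFamily : Set₁
FunFamily = Pred (ℕ → ℕ) 0ℓ

Finite : Subset → Set
Finite A = ∃[ xs ] A ≐ (_∈ˡ xs)

record IsIdeal (𝓘 : Family 0ℓ) : Set₁ where
  field
    ∪-closed : ∀ {A B} → A ∈ 𝓘 → B ∈ 𝓘 → (A ∪ B) ∈ 𝓘
    ⊆-closed : ∀ {A B} → A ⊆ B → B ∈ 𝓘 → A ∈ 𝓘
    finite∈  : ∀ {A} → Finite A → A ∈ 𝓘
    ω∉       : U ∉ 𝓘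

record IsUltrafilter (𝓤 : Family 0ℓ) : Set₁ where
  field
    ∩-closed  : ∀ {A B} → A ∈ 𝓤 → B ∈ 𝓤 → (A ∩ B) ∈ 𝓤
    ⊇-closed  : ∀ {A B} → A ⊆ B → A ∈ 𝓤 → B ∈ 𝓤
    ∅∉        : ∅ ∉ 𝓤
    ultra     : ∀ A → A ∈ 𝓤 ⊎ ∁ A ∈ 𝓤
    cofinite∈ : ∀ {A} → Finite (∁ A) → A ∈ 𝓤

infix 30 _⁺ _*

_⁺ : Family 0ℓ → Family 0ℓ
𝓙 ⁺ = ∁ 𝓙

_* : Family 0ℓ → Family (lsuc 0ℓ)
(𝓤 *) B = ∃[ A ] A ∈ 𝓤 × B ≐ ∁ A

infix 4 _≤[_]_

_≤[_]_ : Family ℓ₁ → FunFamily → Family ℓ₂ → Set (lsuc 0ℓ ⊔ ℓ₁ ⊔ ℓ₂)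
𝓘 ≤[ 𝓕 ] 𝓚 = ∃[ f ] f ∈ 𝓕 × (∀ B → B ∈ 𝓘 → (f ⊢ B) ∈ 𝓚)

AllFunctions FiniteToOne OneToOne : FunFamily
AllFunctions  = U
FiniteToOne f = ∀ m → Finite (f ⊢ ｛ m ｝)
OneToOne    f = Injective _≡_ _≡_ f

IsIUltrafilter IsWeakIUltrafilter IsIPoint : Family 0ℓ → Family 0ℓ → Set₁
IsIUltrafilter     𝓘 𝓤 = IsUltrafilter 𝓤 × ¬ (𝓘 ≤[ AllFunctions ] 𝓤 *)
IsWeakIUltrafilter 𝓘 𝓤 = IsUltrafilter 𝓤 × ¬ (𝓘 ≤[ FiniteToOne ] 𝓤 *)
IsIPoint           𝓘 𝓤 = IsUltrafilter 𝓤 × ¬ (𝓘 ≤[ OneToOne ] 𝓤 *)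

-- The empty intersection is ω.
⋂ : List Subset → Subset
⋂ = foldr _∩_ U

HasFIP : Family 0ℓ → Family 0ℓ → Set₁
HasFIP 𝓙 𝓐 = ∃ 𝓐 × (∀ As → All (_∈ 𝓐) As → ⋂ As ∈ 𝓙 ⁺)

infixl 6 _⊕_

_⊕_ : Family 0ℓ → Subset → Family 0ℓ
(𝓐 ⊕ B) C = C ∈ 𝓐 ⊎ C ≐ B

-- A cardinal is represented by a setoid having that cardinality; two setoids
-- represent the same cardinal when they are in bijection.

infix 4 _≼_ _≺_ _≈ᶜ_

_≼_ _≺_ _≈ᶜ_ : Setoid a ℓ₁ → Setoid b ℓ₂ → Set _
κ ≼ μ  = Injection κ μ
κ ≺ μ  = κ ≼ μ × ¬ (μ ≼ κ)
κ ≈ᶜ μ = Bijection κ μ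

∣_∣ᶠ : FunFamily → Setoid 0ℓ 0ℓ
∣ 𝓕 ∣ᶠ = On.setoid {B = ∃ 𝓕} (ℕ →-setoid ℕ) proj₁

∣_∣ : Family 0ℓ → Setoid (lsuc 0ℓ) 0ℓ
∣ 𝓐 ∣ = On.setoid {B = ∃ 𝓐} (≐-setoid ℕ 0ℓ) proj₁

𝟙 : Setoid 0ℓ 0ℓ
𝟙 = setoid (Fin 1)

𝔠 : Setoid 0ℓ 0ℓ
𝔠 = ℕ →-setoid Bool

-- The level at which families of subsets of ω have their cardinality.
Cardinal : Set₂
Cardinal = Setoid (lsuc 0ℓ) 0ℓ

IsSuccessorOf : Setoid a ℓ → Cardinal → Set _
IsSuccessorOf κ κ⁺ = κ ≺ κ⁺ × (∀ (μ : Cardinal) → κ ≺ μ → κ⁺ ≼ μ)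

IsMinimum : Pred Cardinal ℓ → Cardinal → Set _
IsMinimum P κ = κ ∈ P × (∀ μ → μ ∈ P → κ ≼ μ)

FipCandidate : Family 0ℓ → Family 0ℓ → FunFamily → Pred Cardinal (lsuc (lsuc 0ℓ))
FipCandidate 𝓘 𝓙 𝓕 κ =
  IsSuccessorOf 𝔠 κ
  ⊎ (∃[ 𝓐 ] κ ≈ᶜ ∣ 𝓐 ∣
          × HasFIP 𝓙 𝓐
          × ¬ (∀ f → f ∈ 𝓕 → ∃[ B ] B ∈ 𝓘 × HasFIP 𝓙 (𝓐 ⊕ (f ⊢ B))))

-- fip(𝓘,𝓙,𝓕) = κ, as an equality of cardinals.
IsFip : Family 0ℓ → Family 0ℓ → FunFamily → Cardinal → Set₂
IsFip 𝓘 𝓙 𝓕 = IsMinimum (FipCandidate 𝓘 𝓙 𝓕)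

{-# OPTIONS --safe #-}
module Submission where

-- Index 𝓕 by a set K and give K a well-order of minimal type, so that K does not
-- inject into a proper initial segment (minimalWellOrder).  By recursion along it
-- choose sets B k in 𝓘 such that all the preimages of the B l under f l, for
-- l ≤ k, together have the 𝓙⁺-FIP.  This is possible: the preimages chosen
-- before k have the property, because a finite subfamily is covered by its latest
-- index (preimages-FIP), and there are fewer than fip of them, since otherwise
-- K, which embeds in fip, would embed below k.  By definition of fip such a family can be
-- extended by a preimage under f k (below-fip).  At the least index the family
-- with the single member ω is extended instead; it has fewer than fip members
-- unless fip and 𝓕 both have cardinality one.
--
-- The family of all these preimages has the 𝓙⁺-FIP, so it lies in an ultrafilter
-- 𝓤 disjoint from 𝓙, and hence 𝓙 ⊆ 𝓤 * (ultrafilter).  For f in 𝓕 some preimage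
-- of a set of 𝓘 belongs to 𝓤, so f does not witness that 𝓘 is below 𝓤 *.  The
-- special cases follow, because the identity witnesses that 𝓙 is below 𝓤 *, and
-- each of the three classes of functions has at least two members.
--
-- Well-orders and maximal families both come from Zermelo's towers of subsets
-- (Growth).  Choice enters only through normal forms: every setoid has a
-- map to representatives that turns its equality into propositional equality.
-- After normalising predicates, selection and recursion respect extensional
-- equality.

open import Defs
open import Data.Product.Base using (_×_; ∃-syntax)
open import Level using (0ℓ)
open import Relation.Nullary.Negation using (¬_)
open import Relation.Unary using (_⊆_; _≐_)

open import Data.Empty using (⊥-elim)
open import Data.Fin.Base as Fin using (Fin)
open import Data.List.Base using ([]; _∷_; _++_)
open import Data.List.Relation.Unary.All as All using (All; []; _∷_)
open import Data.List.Relation.Unary.All.Properties using (++⁺)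
open import Data.List.Relation.Unary.Any using (here)
open import Data.Maybe.Base using (Maybe; just; nothing; fromMaybe)
open import Data.Maybe.Properties using (just-injective)
open import Data.Nat.Base using (ℕ; zero; suc)
open import Data.Nat.Properties using (suc-injective)
open import Data.Product.Base using (Σ; ∃; _,_; proj₁; proj₂)
open import Data.Sum.Base using (_⊎_; inj₁; inj₂; [_,_]′)
open import Data.Unit.Base using (tt)
open import Function.Base using (id; const; _∘_; _on_)
open import Function.Bundles using (Func; Injection; Bijection)
import Function.Construct.Composition as Composition
import Function.Construct.Identity as Identity
open import Function.Definitions using (Injective)
open import Induction.WellFounded using (Acc; acc; WellFounded)
open import Level using (Level; _⊔_) renaming (suc to lsuc)
open import Relation.Binary.Bundles using (Setoid)
import Relation.Binary.Construct.On as On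
open import Relation.Binary.Core using (Rel)
open import Relation.Binary.PropositionalEquality using (_≡_; refl; sym; trans; cong; subst; setoid)
open import Relation.Binary.PropositionalEquality.WithK using (≡-irrelevant)
open import Relation.Nullary.Decidable using (yes; no; True; toWitness; fromWitness; decidable-stable)
open import Relation.Unary using (Pred; _∈_; _∉_; _∪_; _∩_; ∁; U; ∅; _⊢_)
open import Relation.Unary.Properties using (≐-refl)
open import Relation.Unary.Relation.Binary.Equality using (≐-setoid)

private variable
  a b ℓ p : Level

-- Consequences of excluded middle and choice

module _ (em : Classical) where

  -- Any proposition has an equivalent in the lowest universe, so quantifying
  -- over all subsets of a set still defines a subset of it.
  ⌊_⌋ : Set ℓ → Set
  ⌊ P ⌋ = True (em {P = P})

  ⌊⌋⁺ : {P : Set ℓ} → P → ⌊ P ⌋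
  ⌊⌋⁺ = fromWitness

  ⌊⌋⁻ : {P : Set ℓ} → ⌊ P ⌋ → P
  ⌊⌋⁻ = toWitness

  by-contradiction : {P : Set ℓ} → ¬ ¬ P → P
  by-contradiction = decidable-stable em

  -- Excluded middle decides arbitrary types and not just propositions, so it
  -- already selects witnesses.  The selection depends on the predicate itself,
  -- not only on its extension.
  pick : {A : Set a} → Pred A p → Maybe A
  pick P with em {P = ∃ P}
  ... | yes (x , _) = just x
  ... | no  _       = nothing

  pick-sound : {A : Set a} (P : Pred A p) {x : A} → pick P ≡ just x → x ∈ P
  pick-sound P eq with em {P = ∃ P}
  pick-sound P refl | yes (_ , Px) = Px
  pick-sound P ()   | no  _

  pick-complete : {A : Set a} (P : Pred A p) → ∃ P → ∃[ x ] pick P ≡ just x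
  pick-complete P ∃P with em {P = ∃ P}
  ... | yes (x , _) = x , refl
  ... | no  ∄P      = ⊥-elim (∄P ∃P)

  least : {A : Set a} {_<_ : Rel A ℓ} → WellFounded _<_ → (P : Pred A p) → ∃ P →
          ∃[ x ] x ∈ P × (∀ {y} → y < x → y ∉ P)
  least {_<_ = _<_} wf P (x , Px) = go (wf x) Px
    where
    go : ∀ {x} → Acc _<_ x → x ∈ P → ∃[ m ] m ∈ P × (∀ {y} → y < m → y ∉ P)
    go {x} (acc rs) Px with em {P = ∃[ y ] y < x × y ∈ P}
    ... | yes (y , y<x , Py) = go (rs y<x) Py
    ... | no  none           = x , Px , λ y<x Py → none (_ , y<x , Py)

module _ (choice : Choice) (S : Setoid a ℓ) where
  open Setoid S using (Carrier; _≈_) renaming (refl to ≈-refl)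

  -- Choice applied to the identity, from the carrier with propositional equality
  -- onto the setoid: a section picks one representative of each class.  Applied
  -- to predicates under _≐_, it makes any construction extensional.
  private
    section = choice {S = setoid Carrier} {T = S} record
      { to = id ; cong = λ { refl → ≈-refl } ; surjective = λ y → y , λ { refl → ≈-refl } }

  normalise : Carrier → Carrier
  normalise = Func.to (proj₁ section)

  normalise-cong : ∀ {x y} → x ≈ y → normalise x ≡ normalise y
  normalise-cong = Func.cong (proj₁ section)

  normalise-≈ : ∀ x → normalise x ≈ x
  normalise-≈ = proj₂ section

  -- The normal forms under propositional equality; uniqueness of identity proofs
  -- makes the witness of normality immaterial.
  transversal : Σ (Set a) λ K → setoid K ≈ᶜ S
  transversal = (∃[ x ] normalise x ≡ x) , record
    { to        = proj₁
    ; cong      = λ { refl → ≈-refl }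
    ; bijective = (λ {k} {l} → inj k l)
                , λ y → (normalise y , normalise-cong (normalise-≈ y))
                , λ { refl → normalise-≈ y }
    }
    where
    inj : (k l : ∃[ x ] normalise x ≡ x) → proj₁ k ≈ proj₁ l → k ≡ l
    inj (x , nx) (y , ny) x≈y with trans (sym nx) (trans (normalise-cong x≈y) ny)
    ... | refl = cong (x ,_) (≡-irrelevant nx ny)

-- Zermelo's towers

-- Starting from ∅, the next stage adds one admissible element, selected by
-- choice, and unions are taken at limits.  The stages form a chain.  Well-ordering
-- and the existence of maximal families are the two instances used below.
module Growth (em : Classical) (choice : Choice) {X : Set a} (Admissible : Pred X 0ℓ → Pred X ℓ)
              (Admissible-resp : ∀ {S R x} → S ≐ R → x ∈ Admissible S → x ∈ Admissible R)
              (Admissible⇒∉ : ∀ {S x} → x ∈ Admissible S → x ∉ S) where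

  private
    nf      = normalise choice (≐-setoid X 0ℓ)
    nf-cong = normalise-cong choice (≐-setoid X 0ℓ)
    nf-≈    = normalise-≈ choice (≐-setoid X 0ℓ)

  chosen : Pred X 0ℓ → Maybe X
  chosen S = pick em (Admissible (nf S))

  chosen-cong : ∀ {S R} → S ≐ R → chosen S ≡ chosen R
  chosen-cong S≐R = cong (pick em ∘ Admissible) (nf-cong S≐R)

  chosen-sound : ∀ {S x} → chosen S ≡ just x → x ∈ Admissible S
  chosen-sound {S} eq = Admissible-resp (nf-≈ S) (pick-sound em (Admissible (nf S)) eq)

  chosen-complete : ∀ {S} → ∃ (Admissible S) → ∃[ x ] chosen S ≡ just x
  chosen-complete {S} (x , adm) =
    pick-complete em (Admissible (nf S)) (x , Admissible-resp (proj₂ (nf-≈ S) , proj₁ (nf-≈ S)) adm)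

  next : Pred X 0ℓ → Pred X 0ℓ
  next S = S ∪ λ x → ⌊_⌋ em (chosen S ≡ just x)

  next-mono-≐ : ∀ {S R} → S ≐ R → next S ⊆ next R
  next-mono-≐ (S⊆R , _) (inj₁ x∈S) = inj₁ (S⊆R x∈S)
  next-mono-≐ S≐R       (inj₂ eq)  =
    inj₂ (⌊⌋⁺ em (trans (sym (chosen-cong S≐R)) (⌊⌋⁻ em eq)))

  ⋃ₛ : Pred (Pred X 0ℓ) 0ℓ → Pred X 0ℓ
  ⋃ₛ 𝓓 x = ⌊_⌋ em (∃[ S ] S ∈ 𝓓 × x ∈ S)

  ⋃ₛ-upper : ∀ {𝓓 S} → S ∈ 𝓓 → S ⊆ ⋃ₛ 𝓓
  ⋃ₛ-upper S∈𝓓 x∈S = ⌊⌋⁺ em (_ , S∈𝓓 , x∈S)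

  ⋃ₛ-least : ∀ {𝓓} {R : Pred X 0ℓ} → (∀ {S} → S ∈ 𝓓 → S ⊆ R) → ⋃ₛ 𝓓 ⊆ R
  ⋃ₛ-least below x∈⋃ with ⌊⌋⁻ em x∈⋃
  ... | _ , S∈𝓓 , x∈S = below S∈𝓓 x∈S

  data Stage : Pred (Pred X 0ℓ) (a ⊔ lsuc 0ℓ) where
    next-stage : ∀ {S} → Stage S → Stage (next S)
    ⋃-stage    : ∀ {𝓓} → 𝓓 ⊆ Stage → Stage (⋃ₛ 𝓓)

  -- The tower does not jump over R.  Linearity is proved in two steps: a set
  -- with this property is comparable with every stage S, by induction on S, and
  -- every stage has the property, by induction on that stage.
  NoGap : Pred (Pred X 0ℓ) (a ⊔ lsuc 0ℓ)
  NoGap R = ∀ {S} → Stage S → S ⊆ R → next S ⊆ R ⊎ R ⊆ S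

  noGap⇒comparable : ∀ {R} → NoGap R → ∀ {S} → Stage S → S ⊆ R ⊎ next R ⊆ S
  noGap⇒comparable gap (next-stage st) with noGap⇒comparable gap st
  ... | inj₂ nR⊆S = inj₂ (inj₁ ∘ nR⊆S)
  ... | inj₁ S⊆R with gap st S⊆R
  ...   | inj₁ nS⊆R = inj₁ nS⊆R
  ...   | inj₂ R⊆S  = inj₂ (next-mono-≐ (R⊆S , S⊆R))
  noGap⇒comparable {R} gap (⋃-stage {𝓓} sts) with em {P = ∃[ S ] S ∈ 𝓓 × next R ⊆ S}
  ... | yes (S , S∈𝓓 , nR⊆S) = inj₂ (⋃ₛ-upper S∈𝓓 ∘ nR⊆S)
  ... | no  none             = inj₁ (⋃ₛ-least below)
    where
    below : ∀ {S} → S ∈ 𝓓 → S ⊆ R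
    below S∈𝓓 with noGap⇒comparable gap (sts S∈𝓓)
    ... | inj₁ S⊆R  = S⊆R
    ... | inj₂ nR⊆S = ⊥-elim (none (_ , S∈𝓓 , nR⊆S))

  noGap : ∀ {R} → Stage R → NoGap R
  noGap (next-stage stR) st S⊆nR with noGap⇒comparable (noGap stR) st
  ... | inj₂ nR⊆S = inj₂ nR⊆S
  ... | inj₁ S⊆R with noGap stR st S⊆R
  ...   | inj₁ nS⊆R = inj₁ (inj₁ ∘ nS⊆R)
  ...   | inj₂ R⊆S  = inj₁ (next-mono-≐ (S⊆R , R⊆S))
  noGap (⋃-stage {𝓓} sts) {S} st S⊆⋃ with em {P = ∃[ R ] R ∈ 𝓓 × ¬ (R ⊆ S)}
  ... | no none = inj₂ (⋃ₛ-least λ R∈𝓓 → by-contradiction em λ R⊈S → none (_ , R∈𝓓 , R⊈S))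
  ... | yes (R , R∈𝓓 , R⊈S) with noGap⇒comparable (noGap (sts R∈𝓓)) st
  ...   | inj₂ nR⊆S = ⊥-elim (R⊈S (nR⊆S ∘ inj₁))
  ...   | inj₁ S⊆R with noGap (sts R∈𝓓) st S⊆R
  ...     | inj₁ nS⊆R = inj₁ (⋃ₛ-upper R∈𝓓 ∘ nS⊆R)
  ...     | inj₂ R⊆S  = ⊥-elim (R⊈S R⊆S)

  comparable : ∀ {R S} → Stage R → Stage S → S ⊆ R ⊎ next R ⊆ S
  comparable stR stS = noGap⇒comparable (noGap stR) stS

  -- The largest stage: it contains its own successor, so nothing is admissible.
  final : Pred X 0ℓ
  final = ⋃ₛ λ S → ⌊_⌋ em (Stage S)

  final-stage : Stage final
  final-stage = ⋃-stage (⌊⌋⁻ em)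

  final-saturated : ∀ {x} → x ∉ Admissible final
  final-saturated adm with chosen-complete (_ , adm)
  ... | y , eq = Admissible⇒∉ (chosen-sound {final} eq)
                   (⋃ₛ-upper (⌊⌋⁺ em (next-stage final-stage)) (inj₂ (⌊⌋⁺ em eq)))

-- Well-ordering

record WellOrder (X : Set a) : Set (a ⊔ lsuc 0ℓ) where
  field
    _<_         : Rel X 0ℓ
    transitive  : ∀ {x y z} → x < y → y < z → x < z
    total       : ∀ x y → x < y ⊎ x ≡ y ⊎ y < x
    wellFounded : WellFounded _<_

pullback : {X : Set a} {Y : Set b} (f : X → Y) → Injective _≡_ _≡_ f → WellOrder Y → WellOrder X
pullback f f-inj W = record
  { _<_         = _<_ on f
  ; transitive  = transitive
  ; total       = λ x y → [ inj₁ , [ inj₂ ∘ inj₁ ∘ f-inj , inj₂ ∘ inj₂ ]′ ]′ (total (f x) (f y))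
  ; wellFounded = On.wellFounded f wellFounded
  }
  where open WellOrder W

module _ (em : Classical) (choice : Choice) where

  -- Let every element outside a stage be admissible, and let before x be the largest
  -- stage omitting x.  Its successor must contain x, so x is the element
  -- chosen at before x; hence elements with the same before are equal.  In the
  -- order, x precedes y if x enters strictly before y does; it is well-founded by induction on stages.
  wellOrder : (X : Set a) → WellOrder X
  wellOrder X = record
    { _<_         = λ x y → x ∈ before y
    ; transitive  = λ x<y y<z → before-mono y<z x<y
    ; total       = compare
    ; wellFounded = λ x → accessible (next-stage (before-stage x)) (∈next-before x)
    }
    where
    Outside : Pred X 0ℓ → Pred X 0ℓ
    Outside S x = x ∉ S

    Outside-resp : ∀ {S R x} → S ≐ R → x ∈ Outside S → x ∈ Outside R
    Outside-resp (_ , R⊆S) x∉S x∈R = x∉S (R⊆S x∈R)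

    open Growth em choice Outside Outside-resp id

    before : X → Pred X 0ℓ
    before x = ⋃ₛ λ S → ⌊_⌋ em (Stage S × x ∉ S)

    before-stage : ∀ x → Stage (before x)
    before-stage x = ⋃-stage (proj₁ ∘ ⌊⌋⁻ em)

    ∉before : ∀ x → x ∉ before x
    ∉before x x∈ with ⌊⌋⁻ em x∈
    ... | S , good , x∈S = proj₂ (⌊⌋⁻ em good) x∈S

    before-greatest : ∀ {x S} → Stage S → x ∉ S → S ⊆ before x
    before-greatest st x∉S = ⋃ₛ-upper (⌊⌋⁺ em (st , x∉S))

    ∈next-before : ∀ x → x ∈ next (before x)
    ∈next-before x = by-contradiction em λ x∉ →
      let _ , eq = chosen-complete (x , ∉before x) in
      chosen-sound {before x} eq
        (before-greatest (next-stage (before-stage x)) x∉ (inj₂ (⌊⌋⁺ em eq)))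

    chosen-before : ∀ x → chosen (before x) ≡ just x
    chosen-before x with ∈next-before x
    ... | inj₁ x∈ = ⊥-elim (∉before x x∈)
    ... | inj₂ eq = ⌊⌋⁻ em eq

    before-mono : ∀ {x y} → x ∈ before y → before x ⊆ before y
    before-mono {x} {y} x<y with comparable (before-stage y) (before-stage x)
    ... | inj₁ x⊆y  = x⊆y
    ... | inj₂ ny⊆x = ⊥-elim (∉before x (ny⊆x (inj₁ x<y)))

    compare : ∀ x y → x ∈ before y ⊎ x ≡ y ⊎ y ∈ before x
    compare x y with comparable (before-stage y) (before-stage x)
                   | comparable (before-stage x) (before-stage y)
    ... | inj₂ ny⊆x | _         = inj₂ (inj₂ (ny⊆x (∈next-before y)))
    ... | inj₁ _    | inj₂ nx⊆y = inj₁ (nx⊆y (∈next-before x))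
    ... | inj₁ x⊆y  | inj₁ y⊆x  = inj₂ (inj₁ (just-injective
      (trans (sym (chosen-before x)) (trans (chosen-cong (x⊆y , y⊆x)) (chosen-before y)))))

    accessible : ∀ {S x} → Stage S → x ∈ S → Acc (λ y z → y ∈ before z) x
    accessible (next-stage st) (inj₁ x∈S) = accessible st x∈S
    accessible {x = x} (next-stage {S} st) (inj₂ eq) = acc λ {y} y<x →
      accessible st (before⊆S y<x)
      where
      before⊆S : before x ⊆ S
      before⊆S with comparable st (before-stage x)
      ... | inj₁ x⊆S  = x⊆S
      ... | inj₂ nS⊆x = ⊥-elim (∉before x (nS⊆x (inj₂ eq)))
    accessible (⋃-stage sts) x∈⋃ with ⌊⌋⁻ em x∈⋃
    ... | _ , S∈𝓓 , x∈S = accessible (sts S∈𝓓) x∈S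

  -- An order whose type is an initial ordinal: X does not inject into any proper
  -- initial segment.  If a given well-order fails this, pull it back along an
  -- injection of X into the least offending segment; an injection below f x in
  -- the pullback would give an offending segment at f x, contrary to leastness.
  minimalWellOrder : (X : Set a) → Σ (WellOrder X) λ W → let open WellOrder W in
                     ∀ x → ¬ (∃[ f ] Injective {A = X} {B = X} _≡_ _≡_ f × (∀ y → f y < x))
  minimalWellOrder X with em {P = ∃ Bounds}
    where
    open WellOrder (wellOrder X)
    Bounds : Pred X _
    Bounds x = ∃[ f ] Injective {A = X} {B = X} _≡_ _≡_ f × (∀ y → f y < x)
  ... | no  none = wellOrder X , λ x bound → none (x , bound)
  ... | yes some with least em (WellOrder.wellFounded (wellOrder X)) _ some
  ...   | m , (f , f-inj , f<m) , minimal =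
    pullback f f-inj (wellOrder X) ,
    λ x (g , g-inj , g<x) → minimal (f<m x) (f ∘ g , g-inj ∘ f-inj , g<x)

-- Ultrafilters extending a family with the finite intersection property

-- HasFIP without inhabitation, so that it holds of the empty initial family.
FIP : Family 0ℓ → Family ℓ → Set (lsuc 0ℓ ⊔ ℓ)
FIP 𝓙 𝓐 = ∀ As → All (_∈ 𝓐) As → ⋂ As ∈ 𝓙 ⁺

FIP-antitone : (𝓙 : Family 0ℓ) {𝓐 : Family a} {𝓑 : Family b} → 𝓐 ⊆ 𝓑 → FIP 𝓙 𝓑 → FIP 𝓙 𝓐
FIP-antitone _ 𝓐⊆𝓑 fip As As∈ = fip As (All.map 𝓐⊆𝓑 As∈)

FIP-⊕-antitone : (𝓙 : Family 0ℓ) {𝓐 𝓑 : Family 0ℓ} {A : Subset} → 𝓐 ⊆ 𝓑 →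
                 FIP 𝓙 (𝓑 ⊕ A) → FIP 𝓙 (𝓐 ⊕ A)
FIP-⊕-antitone 𝓙 𝓐⊆𝓑 = FIP-antitone 𝓙 λ where
  (inj₁ C∈𝓐) → inj₁ (𝓐⊆𝓑 C∈𝓐)
  (inj₂ C≐A) → inj₂ C≐A

⋂-++ : ∀ As {Bs} → ⋂ (As ++ Bs) ⊆ ⋂ As ∩ ⋂ Bs
⋂-++ []       n∈         = tt , n∈
⋂-++ (A ∷ As) (n∈A , n∈) = let n∈As , n∈Bs = ⋂-++ As n∈ in (n∈A , n∈As) , n∈Bs

-- The copies of A among As can be collected into a single factor.
⊕-⋂ : {𝓐 : Family 0ℓ} {A : Subset} → ∀ {As} → All (_∈ 𝓐 ⊕ A) As →
      ∃[ Bs ] All (_∈ 𝓐) Bs × ⋂ Bs ∩ A ⊆ ⋂ As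
⊕-⋂ [] = [] , [] , λ _ → tt
⊕-⋂ (C∈ ∷ As∈) with C∈ | ⊕-⋂ As∈
... | inj₁ C∈𝓐       | Bs , Bs∈ , sub = _ , C∈𝓐 ∷ Bs∈ , λ ((c , bs) , a) → c , sub (bs , a)
... | inj₂ (_ , A⊆C) | Bs , Bs∈ , sub = Bs , Bs∈ , λ (bs , a) → A⊆C a , sub (bs , a)

module _ (em : Classical) (choice : Choice) {𝓙 : Family 0ℓ} where

  -- Grow by sets that keep the property.  It survives unions because the stages
  -- form a chain: finitely many members of the union lie in one stage.
  maximalFIP : {𝓐 : Family 0ℓ} → FIP 𝓙 𝓐 →
               ∃[ 𝓜 ] 𝓐 ⊆ 𝓜 × FIP 𝓙 𝓜 × (∀ A → FIP 𝓙 (𝓜 ⊕ A) → A ∈ 𝓜)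
  maximalFIP {𝓐} fip =
    𝓐 ∪ final , inj₁ , stage-FIP final-stage ,
    λ A fipA → by-contradiction em λ A∉ → final-saturated (A∉ ∘ inj₂ , fipA)
    where
    Admissible : Pred Subset 0ℓ → Pred Subset (lsuc 0ℓ)
    Admissible 𝓢 A = A ∉ 𝓢 × FIP 𝓙 ((𝓐 ∪ 𝓢) ⊕ A)

    Admissible-resp : ∀ {𝓢 𝓡 A} → 𝓢 ≐ 𝓡 → A ∈ Admissible 𝓢 → A ∈ Admissible 𝓡
    Admissible-resp (_ , 𝓡⊆𝓢) (A∉𝓢 , fipA) =
      A∉𝓢 ∘ 𝓡⊆𝓢 , FIP-⊕-antitone 𝓙 [ inj₁ , (λ C∈𝓡 → inj₂ (𝓡⊆𝓢 C∈𝓡)) ]′ fipA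

    open Growth em choice Admissible Admissible-resp proj₁

    -- The first alternative covers the empty union, which has no stage to offer.
    cover : ∀ {𝓓} → 𝓓 ⊆ Stage → ∀ {As} → All (_∈ 𝓐 ∪ ⋃ₛ 𝓓) As →
            All (_∈ 𝓐) As ⊎ (∃[ 𝓢 ] 𝓢 ∈ 𝓓 × All (_∈ 𝓐 ∪ 𝓢) As)
    cover sts [] = inj₁ []
    cover sts (A∈ ∷ As∈) with A∈ | cover sts As∈
    ... | inj₁ A∈𝓐 | inj₁ As∈𝓐             = inj₁ (A∈𝓐 ∷ As∈𝓐)
    ... | inj₁ A∈𝓐 | inj₂ (𝓢 , 𝓢∈ , As∈𝓢) = inj₂ (𝓢 , 𝓢∈ , inj₁ A∈𝓐 ∷ As∈𝓢)
    ... | inj₂ A∈⋃ | rest with ⌊⌋⁻ em A∈⋃ | rest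
    ...   | 𝓡 , 𝓡∈ , A∈𝓡 | inj₁ As∈𝓐 = inj₂ (𝓡 , 𝓡∈ , inj₂ A∈𝓡 ∷ All.map inj₁ As∈𝓐)
    ...   | 𝓡 , 𝓡∈ , A∈𝓡 | inj₂ (𝓢 , 𝓢∈ , As∈𝓢) with comparable (sts 𝓡∈) (sts 𝓢∈)
    ...     | inj₁ 𝓢⊆𝓡  = inj₂ (𝓡 , 𝓡∈ , inj₂ A∈𝓡 ∷ All.map [ inj₁ , (λ C∈ → inj₂ (𝓢⊆𝓡 C∈)) ]′ As∈𝓢)
    ...     | inj₂ n𝓡⊆𝓢 = inj₂ (𝓢 , 𝓢∈ , inj₂ (n𝓡⊆𝓢 (inj₁ A∈𝓡)) ∷ As∈𝓢)

    stage-FIP : ∀ {𝓢} → Stage 𝓢 → FIP 𝓙 (𝓐 ∪ 𝓢)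
    stage-FIP (next-stage {𝓢} st) with em {P = ∃[ A ] chosen 𝓢 ≡ just A}
    ... | no  none     = FIP-antitone 𝓙
      (λ { (inj₁ C∈)        → inj₁ C∈
         ; (inj₂ (inj₁ C∈)) → inj₂ C∈
         ; (inj₂ (inj₂ eq)) → ⊥-elim (none (_ , ⌊⌋⁻ em eq)) }) (stage-FIP st)
    ... | yes (A , eqA) = FIP-antitone 𝓙
      (λ { (inj₁ C∈)        → inj₁ (inj₁ C∈)
         ; (inj₂ (inj₁ C∈)) → inj₁ (inj₂ C∈)
         ; {C} (inj₂ (inj₂ eq)) → inj₂ (subst (C ≐_) (just-injective (trans (sym (⌊⌋⁻ em eq)) eqA)) ≐-refl) })
      (proj₂ (chosen-sound {𝓢} eqA))
    stage-FIP (⋃-stage sts) As As∈ with cover sts As∈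
    ... | inj₁ As∈𝓐            = fip As As∈𝓐
    ... | inj₂ (_ , 𝓢∈ , As∈𝓢) = stage-FIP (sts 𝓢∈) As As∈𝓢

  -- A family that is maximal with the 𝓙⁺-FIP is an ultrafilter containing the
  -- dual filter of 𝓙: a set A can be added as soon as no finite intersection of
  -- members meets A in a set of 𝓙.
  ultrafilter : IsIdeal 𝓙 → {𝓐 : Family 0ℓ} → FIP 𝓙 𝓐 →
                ∃[ 𝓤 ] IsUltrafilter 𝓤 × 𝓐 ⊆ 𝓤 × 𝓙 ⊆ 𝓤 *
  ultrafilter ideal fip𝓐 with maximalFIP fip𝓐
  ... | 𝓤 , 𝓐⊆𝓤 , fip , maximal = 𝓤 , isUltrafilter , 𝓐⊆𝓤 ,
    λ {A} A∈𝓙 → ∁ A , co-𝓙 (⊆-closed (by-contradiction em) A∈𝓙)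
              , (λ n∈A n∉A → n∉A n∈A) , by-contradiction em
    where
    open IsIdeal ideal

    member : ∀ {A} → (∀ Bs → All (_∈ 𝓤) Bs → (⋂ Bs ∩ A) ∉ 𝓙) → A ∈ 𝓤
    member {A} meets = maximal A λ As As∈ ⋂As∈𝓙 →
      let Bs , Bs∈ , sub = ⊕-⋂ As∈ in meets Bs Bs∈ (⊆-closed sub ⋂As∈𝓙)

    -- A resolution step: if A is small on B and C is small off B, then A ∩ C is small.
    split : ∀ {A B} → A ∩ B ∈ 𝓙 → ∀ {C} → C ∩ ∁ B ∈ 𝓙 → A ∩ C ∈ 𝓙
    split {A} {B} A∩B {C} C∖B = ⊆-closed cases (∪-closed A∩B C∖B)
      where
      cases : A ∩ C ⊆ (A ∩ B) ∪ (C ∩ ∁ B)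
      cases {n} (n∈A , n∈C) with em {P = n ∈ B}
      ... | yes n∈B = inj₁ (n∈A , n∈B)
      ... | no  n∉B = inj₂ (n∈C , n∉B)

    co-𝓙 : ∀ {A} → ∁ A ∈ 𝓙 → A ∈ 𝓤
    co-𝓙 ∁A∈𝓙 = member λ Bs Bs∈ Bs∩A∈𝓙 → fip Bs Bs∈
      (⊆-closed (λ n∈ → n∈ , tt) (split Bs∩A∈𝓙 {C = U} (⊆-closed proj₂ ∁A∈𝓙)))

    ∅∈𝓙 : ∅ ∈ 𝓙
    ∅∈𝓙 = finite∈ ([] , (λ ()) , λ ())

    decide : ∀ A → A ∈ 𝓤 ⊎ ∁ A ∈ 𝓤
    decide A with em {P = ∃[ Bs ] All (_∈ 𝓤) Bs × ⋂ Bs ∩ A ∈ 𝓙}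
    ... | no  none                 = inj₁ (member λ Bs Bs∈ small → none (Bs , Bs∈ , small))
    ... | yes (Bs , Bs∈ , Bs∩A∈𝓙) = inj₂ (member λ Cs Cs∈ Cs∖A∈𝓙 →
      fip (Bs ++ Cs) (++⁺ Bs∈ Cs∈) (⊆-closed (⋂-++ Bs) (split Bs∩A∈𝓙 Cs∖A∈𝓙)))

    isUltrafilter : IsUltrafilter 𝓤
    isUltrafilter = record
      { ∩-closed  = λ {A} {B} A∈ B∈ → member λ Bs Bs∈ small →
          fip (A ∷ B ∷ Bs) (A∈ ∷ B∈ ∷ Bs∈) (⊆-closed (λ (a , b , bs) → bs , a , b) small)
      ; ⊇-closed  = λ {A} A⊆B A∈ → member λ Bs Bs∈ small →
          fip (A ∷ Bs) (A∈ ∷ Bs∈) (⊆-closed (λ (a , bs) → bs , A⊆B a) small)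
      ; ∅∉        = λ ∅∈ → fip (∅ ∷ []) (∅∈ ∷ []) (⊆-closed proj₁ ∅∈𝓙)
      ; ultra     = decide
      ; cofinite∈ = co-𝓙 ∘ finite∈
      }

-- Choosing the preimages one at a time

module Recursion (em : Classical) (choice : Choice) {𝓘 𝓙 : Family 0ℓ} (ω∉𝓙 : U ∉ 𝓙)
                 {K : Set} (W : WellOrder K) (f : K → ℕ → ℕ) where
  open WellOrder W

  preimages : Pred K 0ℓ → (K → Subset) → Family 0ℓ
  preimages D B C = ∃[ k ] k ∈ D × C ≐ (f k ⊢ B k)

  Suitable : K → Family 0ℓ → Pred Subset (lsuc 0ℓ)
  Suitable k 𝓐 B = B ∈ 𝓘 × FIP 𝓙 (𝓐 ⊕ (f k ⊢ B))

  -- Finitely many preimages have a latest index k, so all of them lie in the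
  -- family below k enlarged by the preimage at k.
  preimages-FIP : ∀ {D B} → (∀ k → k ∈ D → FIP 𝓙 (preimages (_< k) B ⊕ (f k ⊢ B k))) →
                  FIP 𝓙 (preimages D B)
  preimages-FIP {D} {B} fip As As∈ with latest As∈
    where
    latest : ∀ {As} → All (_∈ preimages D B) As →
             As ≡ [] ⊎ (∃[ k ] k ∈ D × All (_∈ preimages (_< k) B ⊕ (f k ⊢ B k)) As)
    latest [] = inj₁ refl
    latest ((k , k∈D , A≐) ∷ As∈) with latest As∈
    ... | inj₁ refl = inj₂ (k , k∈D , inj₂ A≐ ∷ [])
    ... | inj₂ (l , l∈D , As∈l) with total k l
    ...   | inj₁ k<l         = inj₂ (l , l∈D , inj₁ (k , k<l , A≐) ∷ As∈l)
    ...   | inj₂ (inj₁ refl) = inj₂ (l , l∈D , inj₂ A≐ ∷ As∈l)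
    ...   | inj₂ (inj₂ l<k)  = inj₂ (k , k∈D , inj₂ A≐ ∷ All.map
      (λ { (inj₁ (m , m<l , C≐)) → inj₁ (m , transitive m<l l<k , C≐)
         ; (inj₂ C≐)             → inj₁ (l , l<k , C≐) }) As∈l)
  ... | inj₁ refl            = ω∉𝓙
  ... | inj₂ (k , k∈D , As∈k) = fip k k∈D As As∈k

  private
    nf      = normalise choice (≐-setoid Subset 0ℓ)
    nf-cong = normalise-cong choice (≐-setoid Subset 0ℓ)
    nf-≈    = normalise-≈ choice (≐-setoid Subset 0ℓ)

  -- The value ∅ is a dummy, taken only if no suitable set exists.
  choose : K → Family 0ℓ → Subset
  choose k 𝓐 = fromMaybe ∅ (pick em (Suitable k (nf 𝓐)))

  choose-suitable : ∀ k 𝓐 → ∃ (Suitable k 𝓐) → choose k 𝓐 ∈ Suitable k 𝓐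
  choose-suitable k 𝓐 (B , B∈𝓘 , fip)
    with pick-complete em (Suitable k (nf 𝓐)) (B , B∈𝓘 , FIP-⊕-antitone 𝓙 (proj₁ (nf-≈ 𝓐)) fip)
  ... | C , eq with pick-sound em (Suitable k (nf 𝓐)) eq
  ...   | C∈𝓘 , fipC rewrite eq = C∈𝓘 , FIP-⊕-antitone 𝓙 (proj₂ (nf-≈ 𝓐)) fipC

  -- The preimages below k as the recursion sees them.  Were B not to depend on the
  -- proof of l < k, this would be preimages (_< k) B.
  prior : ∀ k → (∀ l → l < k → Subset) → Family 0ℓ
  prior k B C = ∃[ l ] Σ (l < k) λ l<k → C ≐ (f l ⊢ B l l<k)

  build : ∀ k → Acc _<_ k → Subset
  build k (acc rs) = choose k (prior k λ l l<k → build l (rs l<k))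

  B : K → Subset
  B k = build k (wellFounded k)

  prior-cong : ∀ {k B C} → (∀ l l<k → B l l<k ≡ C l l<k) → prior k B ⊆ prior k C
  prior-cong B≡C (l , l<k , A≐) = l , l<k , subst (λ X → _ ≐ (f l ⊢ X)) (B≡C l l<k) A≐

  choose-cong : ∀ {k B C} → (∀ l l<k → B l l<k ≡ C l l<k) → choose k (prior k B) ≡ choose k (prior k C)
  choose-cong {k} B≡C = cong (fromMaybe ∅ ∘ pick em ∘ Suitable k)
    (nf-cong (prior-cong B≡C , prior-cong λ l l<k → sym (B≡C l l<k)))

  -- Accessibility proofs need not be equal, but the families they give rise to have
  -- the same members, and choose normalises its argument.
  build-irrelevant : ∀ k (a a′ : Acc _<_ k) → build k a ≡ build k a′
  build-irrelevant k (acc rs) (acc rs′) =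
    choose-cong λ l l<k → build-irrelevant l (rs l<k) (rs′ l<k)

  build-unfold : ∀ k (a : Acc _<_ k) → build k a ≡ choose k (preimages (_< k) B)
  build-unfold k (acc rs) = choose-cong λ l l<k → build-irrelevant l (rs l<k) (wellFounded l)

  module _ (extend : ∀ k (B : K → Subset) → FIP 𝓙 (preimages (_< k) B) →
                     ∃ (Suitable k (preimages (_< k) B))) where

    B-suitable : ∀ k → B k ∈ Suitable k (preimages (_< k) B)
    B-suitable k = go (wellFounded k)
      where
      go : ∀ {k} → Acc _<_ k → B k ∈ Suitable k (preimages (_< k) B)
      go {k} (acc rs) = subst (_∈ Suitable k (preimages (_< k) B)) (sym (build-unfold k (wellFounded k)))
        (choose-suitable k _ (extend k B (preimages-FIP {_< k} {B} λ l l<k → proj₂ (go (rs l<k)))))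

    solution : ∃[ B ] (∀ k → B k ∈ 𝓘) × FIP 𝓙 (preimages U B)
    solution = B , proj₁ ∘ B-suitable , preimages-FIP {U} {B} λ k _ → proj₂ (B-suitable k)

-- Cardinality bounds from fip

≈ᶜ𝟙⁺ : (S : Setoid a ℓ) → let open Setoid S in Carrier → (∀ x y → x ≈ y) → S ≈ᶜ 𝟙
≈ᶜ𝟙⁺ S x eq = record
  { to        = const Fin.zero
  ; cong      = λ _ → refl
  ; bijective = (λ _ → eq _ _) , λ { Fin.zero → x , λ _ → refl }
  }

≈ᶜ𝟙⁻ : {S : Setoid a ℓ} → let open Setoid S in S ≈ᶜ 𝟙 → ∀ x y → x ≈ y
≈ᶜ𝟙⁻ bij x y = Bijection.injective bij (all-equal _ _)
  where
  all-equal : (i j : Fin 1) → i ≡ j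
  all-equal Fin.zero Fin.zero = refl

module _ (em : Classical) (choice : Choice) {𝓘 𝓙 : Family 0ℓ} (ideal𝓙 : IsIdeal 𝓙)
         (𝓕 : FunFamily) (fip : Cardinal) (isFip : IsFip 𝓘 𝓙 𝓕 fip) (𝓕≼fip : ∣ 𝓕 ∣ᶠ ≼ fip) where
  open IsIdeal ideal𝓙

  -- If some f had no such B, then 𝓐 would be one of the families over which fip
  -- is a minimum, so fip would be at most its cardinality.
  below-fip : ∀ {𝓐} → HasFIP 𝓙 𝓐 → ¬ (fip ≼ ∣ 𝓐 ∣) →
              ∀ f → f ∈ 𝓕 → ∃[ B ] B ∈ 𝓘 × HasFIP 𝓙 (𝓐 ⊕ (f ⊢ B))
  below-fip {𝓐} has small = by-contradiction em λ fails →
    small (proj₂ isFip ∣ 𝓐 ∣ (inj₂ (𝓐 , Identity.bijection ∣ 𝓐 ∣ , has , fails)))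

  avoiding-ultrafilter : ¬ (∣ 𝓕 ∣ᶠ ≈ᶜ 𝟙 × fip ≈ᶜ 𝟙) →
                         ∃[ 𝓤 ] IsUltrafilter 𝓤 × ¬ (𝓘 ≤[ 𝓕 ] 𝓤 *) × 𝓙 ⊆ 𝓤 *
  avoiding-ultrafilter nondegenerate with transversal choice ∣ 𝓕 ∣ᶠ
  ... | K , enum with minimalWellOrder em choice K
  ...   | W , minimal = conclude
    where
    open WellOrder W
    open Bijection enum renaming (to to member)

    f : K → ℕ → ℕ
    f k = proj₁ (member k)

    open Recursion em choice {𝓘} {𝓙} ω∉ W f

    K≼fip : setoid K ≼ fip
    K≼fip = Composition.injection (Bijection.injection enum) 𝓕≼fip

    -- Otherwise 𝓕, which embeds in fip, would embed in a proper initial segment, by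
    -- sending each set of the family to the index recorded in its membership proof.
    -- Sets with equal indices are equal.
    earlier-small : ∀ k B → ¬ (fip ≼ ∣ preimages (_< k) B ∣)
    earlier-small k B fip≼ = minimal k (index , index-injective , index<k)
      where
      K≼ = Composition.injection K≼fip fip≼
      index : K → K
      index x = proj₁ (proj₂ (Injection.to K≼ x))
      index<k : ∀ x → index x < k
      index<k x = proj₁ (proj₂ (proj₂ (Injection.to K≼ x)))
      index-injective : Injective _≡_ _≡_ index
      index-injective {x} {y} eq = Injection.injective K≼
        (same (proj₂ (Injection.to K≼ x)) (proj₂ (Injection.to K≼ y)) eq)
        where
        same : ∀ {C D} (c : preimages (_< k) B C) (d : preimages (_< k) B D) →
               proj₁ c ≡ proj₁ d → C ≐ D
        same (_ , _ , C⊆ , ⊆C) (_ , _ , D⊆ , ⊆D) refl = ⊆D ∘ C⊆ , ⊆C ∘ D⊆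

    -- The least index has no predecessors, and the empty family is not allowed in the
    -- definition of fip.  The family whose only member is ω takes its place.
    only-ω : Family 0ℓ
    only-ω C = C ≐ U

    only-ω-FIP : HasFIP 𝓙 only-ω
    only-ω-FIP = (U , ≐-refl) , λ As As∈ ⋂As∈𝓙 → ω∉ (⊆-closed (λ _ → everything As∈) ⋂As∈𝓙)
      where
      everything : ∀ {As} → All (_∈ only-ω) As → ∀ {n} → n ∈ ⋂ As
      everything []                = tt
      everything ((_ , U⊆A) ∷ As∈) = U⊆A tt , everything As∈

    only-ω-small : K → ¬ (fip ≼ ∣ only-ω ∣)
    only-ω-small k fip≼ = nondegenerate
      ( ≈ᶜ𝟙⁺ ∣ 𝓕 ∣ᶠ (member k) (λ x y → Injection.injective 𝓕≼fip {x} {y} (equal _ _))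
      , ≈ᶜ𝟙⁺ fip (Injection.to K≼fip k) equal )
      where
      equal : ∀ x y → Setoid._≈_ fip x y
      equal x y = Injection.injective fip≼
        let C⊆ , ⊆C = proj₂ (Injection.to fip≼ x)
            D⊆ , ⊆D = proj₂ (Injection.to fip≼ y)
        in ⊆D ∘ C⊆ , ⊆C ∘ D⊆

    extend : ∀ k B → FIP 𝓙 (preimages (_< k) B) → ∃ (Suitable k (preimages (_< k) B))
    extend k B fip< with em {P = ∃ (_< k)}
    ... | yes (l , l<k) =
      let C , C∈𝓘 , _ , fipC = below-fip ((f l ⊢ B l , l , l<k , ≐-refl) , fip<) (earlier-small k B)
                                 (f k) (proj₂ (member k))
      in C , C∈𝓘 , fipC
    ... | no  first     =
      let C , C∈𝓘 , _ , fipC = below-fip only-ω-FIP (only-ω-small k) (f k) (proj₂ (member k))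
      in C , C∈𝓘 , FIP-⊕-antitone 𝓙 (λ (l , l<k , _) → ⊥-elim (first (l , l<k))) fipC

    conclude : ∃[ 𝓤 ] IsUltrafilter 𝓤 × ¬ (𝓘 ≤[ 𝓕 ] 𝓤 *) × 𝓙 ⊆ 𝓤 *
    conclude with solution extend
    ... | B , B∈𝓘 , fipB with ultrafilter em choice ideal𝓙 fipB
    ...   | 𝓤 , isUlt , ⊆𝓤 , 𝓙⊆ = 𝓤 , isUlt , avoids , 𝓙⊆
      where
      open IsUltrafilter isUlt
      avoids : ¬ (𝓘 ≤[ 𝓕 ] 𝓤 *)
      avoids (g , g∈𝓕 , g-small) with surjective (g , g∈𝓕)
      ... | k , k↦g with g-small (B k) (B∈𝓘 k)
      ...   | A , A∈𝓤 , g⊢B⊆∁A , _ = ∅∉ (⊇-closed disjoint (∩-closed A∈𝓤 (⊆𝓤 (k , tt , ≐-refl))))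
        where
        disjoint : A ∩ (f k ⊢ B k) ⊆ ∅
        disjoint {n} (n∈A , n∈) = g⊢B⊆∁A (subst (_∈ B k) (k↦g refl n) n∈) n∈A

id-finiteToOne : FiniteToOne id
id-finiteToOne m = m ∷ [] , (λ m≡n → here (sym m≡n)) , λ { (here n≡m) → sym n≡m }

suc-finiteToOne : FiniteToOne suc
suc-finiteToOne zero = [] , (λ ()) , λ ()
suc-finiteToOne (suc m) = m ∷ [] , (λ { refl → here refl }) , λ { (here refl) → refl }

theorem3p2 : Classical → Choice →
    (𝓘 𝓙 : Family 0ℓ) → IsIdeal 𝓘 → IsIdeal 𝓙 →
    (𝓕 : FunFamily) (fip : Cardinal) → IsFip 𝓘 𝓙 𝓕 fip →
    ∣ 𝓕 ∣ᶠ ≼ fip →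
    (¬ (∣ 𝓕 ∣ᶠ ≈ᶜ 𝟙 × fip ≈ᶜ 𝟙) → ∃[ 𝓤 ] IsUltrafilter 𝓤 × ¬ (𝓘 ≤[ 𝓕 ] 𝓤 *) × 𝓙 ⊆ 𝓤 *)
    × (𝓕 ≐ AllFunctions → ∃[ 𝓤 ] IsIUltrafilter 𝓘 𝓤 × ¬ IsIPoint 𝓙 𝓤)
    × (𝓕 ≐ FiniteToOne → ∃[ 𝓤 ] IsWeakIUltrafilter 𝓘 𝓤 × ¬ IsIPoint 𝓙 𝓤)
    × (𝓕 ≐ OneToOne → ∃[ 𝓤 ] IsIPoint 𝓘 𝓤 × ¬ IsIPoint 𝓙 𝓤)
theorem3p2 em choice 𝓘 𝓙 _ ideal𝓙 𝓕 fip isFip 𝓕≼fip =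
  general , special tt tt , special id-finiteToOne suc-finiteToOne , special id suc-injective
  where
  general = avoiding-ultrafilter em choice ideal𝓙 𝓕 fip isFip 𝓕≼fip

  special : {𝓖 : FunFamily} → id ∈ 𝓖 → suc ∈ 𝓖 → 𝓕 ≐ 𝓖 →
            ∃[ 𝓤 ] (IsUltrafilter 𝓤 × ¬ (𝓘 ≤[ 𝓖 ] 𝓤 *)) × ¬ IsIPoint 𝓙 𝓤
  special {𝓖} id∈ suc∈ (𝓕⊆𝓖 , 𝓖⊆𝓕) = as-required (general (two-members ∘ proj₁))
    where
    two-members : ¬ (∣ 𝓕 ∣ᶠ ≈ᶜ 𝟙)
    two-members 𝓕≈𝟙 with ≈ᶜ𝟙⁻ {S = ∣ 𝓕 ∣ᶠ} 𝓕≈𝟙 (id , 𝓖⊆𝓕 id∈) (suc , 𝓖⊆𝓕 suc∈) 0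
    ... | ()

    as-required : (∃[ 𝓤 ] IsUltrafilter 𝓤 × ¬ (𝓘 ≤[ 𝓕 ] 𝓤 *) × 𝓙 ⊆ 𝓤 *) →
                  ∃[ 𝓤 ] (IsUltrafilter 𝓤 × ¬ (𝓘 ≤[ 𝓖 ] 𝓤 *)) × ¬ IsIPoint 𝓙 𝓤
    as-required (𝓤 , isUlt , avoids , 𝓙⊆) =
      𝓤 , (isUlt , λ (g , g∈𝓖 , small) → avoids (g , 𝓖⊆𝓕 g∈𝓖 , small)) ,
      λ (_ , notBelow) → notBelow (id , id , λ B B∈𝓙 → 𝓙⊆ B∈𝓙)
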